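{- Let $q$ be a prime power, let $n$ be an even positive integer, and let $Z$ be a set of $q^n$ matrices over $\mathbb{F}_{q^2}$ of size $n/2\times n/2$ with the property that $A-B$ is nonsingular for all distinct $A,B\in Z$. Let \[ Y=\left\{\begin{pmatrix} I & A^*\\ A & AA^*\end{pmatrix}:A\in Z\right\}\cup\left\{\begin{pmatrix} O & O\\ O & I\end{pmatrix}\right\}, \] where $O$ and $I$ are the zero and identity matrices of size $n/2\times n/2$. Then $Y$ is an $n$-code in $X(n,q)$ of size $q^n+1$.
   Context: For a matrix $A$ over $\mathbb{F}_{q^2}$, $A^*$ denotes the transpose of the matrix obtained by applying $x\mapsto x^q$ to each entry. $X(n,q)$ is the set of $n\times n$ matrices $A$ over $\mathbb{F}_{q^2}$ with $A^*=A$ (Hermitian matrices). A nonempty subset $Y\subseteq X(n,q)$ is a $d$-code if $\operatorname{rank}(A-B)\ge d$ for all distinct $A,B\in Y$. -}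

module Defs where

open import Algebra.Bundles using (CommutativeRing)
import Algebra.Properties.Semiring.Exp as Exp
import Algebra.Properties.Semiring.Sum as Sum
open import Data.Bool.Base using (if_then_else_)
open import Data.Fin.Base using (Fin; cast; splitAt)
import Data.Fin.Properties as Fin
open import Data.Nat.Base using (ℕ; _+_; _^_; _≤_; _≥_)
open import Data.Nat.Divisibility using (_∣_)
open import Data.Nat.DivMod using (_/_; m*[n/m]≡n)
open import Data.Nat.Primality using (Prime)
import Data.Nat.Properties as ℕ
open import Data.Product.Base using (Σ; ∃; ∃₂; ∃-syntax; _×_; _,_; proj₁)
open import Data.Sum.Base using (_⊎_; [_,_]′)
import Data.Sum.Base as ⊎
open import Data.Vec.Functional using (Vector)
import Data.Vec.Functional.Relation.Binary.Pointwise.Properties as Pointwise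
open import Function.Bundles using (Bijection)
open import Level using (Level; _⊔_) renaming (suc to lsuc)
open import Relation.Binary.Bundles using (Setoid)
import Relation.Binary.Construct.On as On
open import Relation.Binary.Definitions using (_Respects_)
open import Relation.Binary.PropositionalEquality as ≡ using (_≡_)
open import Relation.Nullary.Decidable.Core using (does)
open import Relation.Nullary.Negation.Core using (¬_)
open import Relation.Unary using (Pred)

IsPrimePower : ℕ → Set
IsPrimePower q = ∃₂ λ p k → Prime p × k ≥ 1 × q ≡ p ^ k

n/2+n/2≡n : ∀ {n} → 2 ∣ n → n / 2 + n / 2 ≡ n
n/2+n/2≡n {n} 2∣n =
  ≡.trans (≡.cong (n / 2 +_) (≡.sym (ℕ.+-identityʳ (n / 2)))) (m*[n/m]≡n 2∣n)

HasCardinality : ∀ {a ℓ} → Setoid a ℓ → ℕ → Set (a ⊔ ℓ)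
HasCardinality S k = Bijection (≡.setoid (Fin k)) S

record FiniteField (c ℓ : Level) (order : ℕ) : Set (lsuc (c ⊔ ℓ)) where
  field
    commutativeRing : CommutativeRing c ℓ
  open CommutativeRing commutativeRing public
  field
    1≉0         : ¬ (1# ≈ 0#)
    inverse     : ∀ x → ¬ (x ≈ 0#) → ∃ λ y → x * y ≈ 1#
    cardinality : HasCardinality setoid order

module Matrices {c ℓ : Level} {order : ℕ} (F : FiniteField c ℓ order) where

  private module F = FiniteField F
  open F using (Carrier; _≈_; 0#; 1#)
  open Sum F.semiring using (sum)

  Matrix : ℕ → ℕ → Set c
  Matrix m n = Vector (Vector Carrier n) m

  matrixSetoid : ℕ → ℕ → Setoid c ℓ
  matrixSetoid m n = Pointwise.setoid (Pointwise.setoid F.setoid n) m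

  infix 4 _≈ᴹ_
  _≈ᴹ_ : ∀ {m n} → Matrix m n → Matrix m n → Set ℓ
  A ≈ᴹ B = ∀ i j → A i j ≈ B i j

  O : ∀ {m n} → Matrix m n
  O i j = 0#

  I : ∀ {n} → Matrix n n
  I i j = if does (i Fin.≟ j) then 1# else 0#

  infixl 6 _-ᴹ_
  _-ᴹ_ : ∀ {m n} → Matrix m n → Matrix m n → Matrix m n
  (A -ᴹ B) i j = A i j F.- B i j

  infixl 7 _*ᴹ_
  _*ᴹ_ : ∀ {l m n} → Matrix l m → Matrix m n → Matrix l n
  (A *ᴹ B) i j = sum (λ k → A i k F.* B k j)

  Nonsingular : ∀ {n} → Matrix n n → Set (c ⊔ ℓ)
  Nonsingular A = ∃[ B ] (A *ᴹ B ≈ᴹ I) × (B *ᴹ A ≈ᴹ I)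

  block : ∀ {h n} → .(h + h ≡ n) → (A B C D : Matrix h h) → Matrix n n
  block {h} h+h≡n A B C D i j =
    [ (λ i′ → [ A i′ , B i′ ]′ (half j))
    , (λ i′ → [ C i′ , D i′ ]′ (half j))
    ]′ (half i)
    where
    half : Fin _ → Fin h ⊎ Fin h
    half k = splitAt h (cast (≡.sym h+h≡n) k)

  LinearlyIndependent : ∀ {m r} → Vector (Vector Carrier m) r → Set (c ⊔ ℓ)
  LinearlyIndependent {m} {r} v =
    (a : Vector Carrier r) →
    (∀ i → sum (λ k → a k F.* v k i) ≈ 0#) →
    ∀ k → a k ≈ 0#

  -- A linearly independent family has no repetitions, so f need not be
  -- required to be injective.
  IndependentColumns : ∀ {m n} → Matrix m n → ℕ → Set (c ⊔ ℓ)
  IndependentColumns {n = n} A r =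
    Σ (Fin r → Fin n) λ f → LinearlyIndependent (λ k i → A i (f k))

  record IsRank {m n : ℕ} (A : Matrix m n) (r : ℕ) : Set (c ⊔ ℓ) where
    field
      attained : IndependentColumns A r
      maximal  : ∀ s → IndependentColumns A s → s ≤ r

  IsRank-unique : ∀ {m n} {A : Matrix m n} {r s} → IsRank A r → IsRank A s → r ≡ s
  IsRank-unique R S = ℕ.≤-antisym (S.maximal _ R.attained) (R.maximal _ S.attained)
    where
    module R = IsRank R
    module S = IsRank S

  record MatrixSet (p : Level) (m n : ℕ) : Set (c ⊔ ℓ ⊔ lsuc p) where
    field
      member   : Pred (Matrix m n) p
      respects : member Respects _≈ᴹ_

  infix 4 _∈_
  _∈_ : ∀ {p m n} → Matrix m n → MatrixSet p m n → Set p
  A ∈ Z = MatrixSet.member Z A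

  HasSize : ∀ {p m n} → MatrixSet p m n → ℕ → Set (c ⊔ ℓ ⊔ p)
  HasSize {m = m} {n} Z =
    HasCardinality (On.setoid {B = ∃ (_∈ Z)} (matrixSetoid m n) proj₁)

module HermitianMatrices {c ℓ : Level} (q : ℕ) (F : FiniteField c ℓ (q ^ 2)) where

  private module F = FiniteField F
  open Matrices F public
  open Exp F.semiring using () renaming (_^_ to _^ᶠ_)

  infix 9 _⋆
  _⋆ : ∀ {m n} → Matrix m n → Matrix n m
  (A ⋆) i j = A j i ^ᶠ q

  X : ∀ n → Pred (Matrix n n) ℓ
  X n A = A ⋆ ≈ᴹ A

  record IsCode {p : Level} {n : ℕ} (d : ℕ) (Y : MatrixSet p n n) : Set (c ⊔ ℓ ⊔ p) where
    field
      nonempty  : ∃[ A ] A ∈ Y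
      hermitian : ∀ A → A ∈ Y → X n A
      distance  : ∀ A B → A ∈ Y → B ∈ Y → ¬ (A ≈ᴹ B) →
                  ∃[ r ] IsRank (A -ᴹ B) r × r ≥ d

  codeMatrix : ∀ {n} → 2 ∣ n → Matrix (n / 2) (n / 2) → Matrix n n
  codeMatrix {n} 2∣n A = block {n / 2} (n/2+n/2≡n 2∣n)
    I  (A ⋆)
    A  (A *ᴹ A ⋆)

  extraMatrix : ∀ {n} → 2 ∣ n → Matrix n n
  extraMatrix {n} 2∣n = block {n / 2} (n/2+n/2≡n 2∣n)
    O  O
    O  I

  codeY : ∀ {p n} → 2 ∣ n → MatrixSet p (n / 2) (n / 2) → MatrixSet (c ⊔ ℓ ⊔ p) n n
  codeY 2∣n Z = record
    { member   = λ M → (∃[ A ] A ∈ Z × M ≈ᴹ codeMatrix 2∣n A) ⊎ M ≈ᴹ extraMatrix 2∣n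
    ; respects = λ M≈N → ⊎.map
        (λ (A , A∈Z , M≈) → A , A∈Z , λ i j → F.trans (F.sym (M≈N i j)) (M≈ i j))
        (λ M≈ i j → F.trans (F.sym (M≈N i j)) (M≈ i j))
    }

{-# OPTIONS --safe #-}

-- Every code matrix factors as (I ; A)(I  A⋆), so it sends (u , w) to (t , A t)
-- with t = u + A⋆ w, while the extra matrix sends (u , w) to (0 , w).  If two
-- distinct elements of Y agree on (u , w), then t is the same for both and
-- (A − B) t = 0 (respectively t = 0 and w = A t), which forces t = 0, w = 0 and
-- u = t − A⋆ w = 0; hence their difference has full rank.  That ⋆ is an
-- involutive anti-automorphism rests on two facts about x ↦ x ^ q on a field of
-- order q²: it is additive (q is a power of the characteristic) and its square
-- is x ↦ x ^ q² = x.
module Submission where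

open import Defs
open import Algebra.Bundles using (CommutativeRing)
import Algebra.Properties.CommutativeMonoid.Sum as CommutativeMonoidSum
import Algebra.Properties.CommutativeSemiring.Binomial as Binomial
import Algebra.Properties.CommutativeSemiring.Exp as Exp
import Algebra.Properties.Ring as RingProperties
import Algebra.Properties.Semiring.Mult as Mult
import Algebra.Properties.Semiring.Sum as Sum
open import Data.Fin.Base using (Fin; zero; suc; fromℕ; fromℕ<; inject₁; cast; splitAt; join; punchIn; _↑ˡ_; _↑ʳ_)
open import Data.Fin.Permutation using (Permutation′; permutation)
import Data.Fin.Properties as Fin
open import Data.Nat.Base as ℕ using (ℕ; zero; suc; NonZero; _+_; _^_; _<_; z<s; s<s)
open import Data.Nat.Combinatorics using (nC1≡n; nCn≡1; nCk+nC[k+1]≡[n+1]C[k+1]; k>n⇒nCk≡0) renaming (_C_ to _choose_)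
open import Data.Nat.Divisibility using (_∣_; divides; m∣m*n; >⇒∤)
open import Data.Nat.DivMod using (_/_)
open import Data.Nat.Primality using (Prime; euclidsLemma; prime⇒nonZero)
import Data.Nat.Properties as ℕ
open import Data.Nat.Tactic.RingSolver using (solve-∀)
open import Data.Product.Base using (∃; _×_; _,_; proj₁; proj₂)
open import Data.Sum.Base using (_⊎_; inj₁; inj₂; [_,_]′)
open import Data.Vec.Functional using (Vector; replicate)
open import Function.Base using (_∘_; id)
open import Function.Bundles using (Bijection)
open import Level using (Level; _⊔_)
open import Relation.Binary.PropositionalEquality as ≡ using (_≡_; _≢_)
open import Relation.Nullary.Decidable.Core using (Dec; yes; no; map′)
open import Relation.Nullary.Negation.Core using (¬_; contradiction)

-- Divisibility of binomial coefficients by a prime.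

-- The absorption identity in division-free form. Pascal's rule splits the coefficient on the left,
-- the identities for `k` and `suc k` one row lower turn both parts into multiples of `suc n`, and
-- Pascal's rule recombines them.
[1+k]*[1+n]C[1+k]≡[1+n]*nCk : ∀ n k → suc k ℕ.* (suc n choose suc k) ≡ suc n ℕ.* (n choose k)
[1+k]*[1+n]C[1+k]≡[1+n]*nCk zero zero = ≡.refl
[1+k]*[1+n]C[1+k]≡[1+n]*nCk zero (suc k)
  rewrite k>n⇒nCk≡0 {1} {suc (suc k)} (s<s z<s) | k>n⇒nCk≡0 {0} {suc k} z<s
  = ℕ.*-zeroʳ k
[1+k]*[1+n]C[1+k]≡[1+n]*nCk (suc n) zero
  rewrite nC1≡n (suc (suc n)) = ≡.trans (ℕ.*-identityˡ _) (≡.sym (ℕ.*-identityʳ _))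
[1+k]*[1+n]C[1+k]≡[1+n]*nCk (suc n) (suc k) = begin
  suc (suc k) ℕ.* (suc (suc n) choose suc (suc k))
    ≡⟨ ≡.cong (suc (suc k) ℕ.*_) (nCk+nC[k+1]≡[n+1]C[k+1] (suc n) (suc k)) ⟨
  suc (suc k) ℕ.* (a + (suc n choose suc (suc k)))
    ≡⟨ expand k a _ ⟩
  a + suc k ℕ.* a + suc (suc k) ℕ.* (suc n choose suc (suc k))
    ≡⟨ ≡.cong₂ (λ x y → a + x + y) ([1+k]*[1+n]C[1+k]≡[1+n]*nCk n k) ([1+k]*[1+n]C[1+k]≡[1+n]*nCk n (suc k)) ⟩
  a + suc n ℕ.* (n choose k) + suc n ℕ.* (n choose suc k)
    ≡⟨ collect n a (n choose k) (n choose suc k) ⟩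
  a + suc n ℕ.* ((n choose k) + (n choose suc k))
    ≡⟨ ≡.cong (λ x → a + suc n ℕ.* x) (nCk+nC[k+1]≡[n+1]C[k+1] n k) ⟩
  suc (suc n) ℕ.* a ∎
  where
  open ≡.≡-Reasoning
  a = suc n choose suc k
  expand : ∀ k a b → suc (suc k) ℕ.* (a + b) ≡ a + suc k ℕ.* a + suc (suc k) ℕ.* b
  expand = solve-∀
  collect : ∀ n a b c → a + suc n ℕ.* b + suc n ℕ.* c ≡ a + suc n ℕ.* (b + c)
  collect = solve-∀

-- By absorption the prime divides `suc k` times the coefficient. It cannot divide `suc k`, which is
-- positive and smaller, so Euclid's lemma leaves the coefficient.
prime∣C : ∀ {n k} → Prime (suc n) → k < n → suc n ∣ suc n choose suc k
prime∣C {n} {k} pr k<n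
  with euclidsLemma (suc k) (suc n choose suc k) pr
         (≡.subst (suc n ∣_) (≡.sym ([1+k]*[1+n]C[1+k]≡[1+n]*nCk n k)) (m∣m*n (n choose k)))
... | inj₁ p∣k = contradiction p∣k (>⇒∤ (s<s k<n))
... | inj₂ p∣C = p∣C

-- Additivity of p-power maps in characteristic p.

module Frobenius {c ℓ} (R : CommutativeRing c ℓ) where

  open CommutativeRing R hiding (zero) renaming (_+_ to _⊕_)
  open Exp commutativeSemiring using (^-congˡ; ^-assocʳ) renaming (_^_ to _^ᴿ_)
  open Mult semiring using (×-congʳ; ×-assoc-*; ×-assocˡ; ×-comm-*; ×-homo-1) renaming (_×_ to _·_)
  open Sum semiring using (sum; sum-cong-≋; sum-init-last; sum-replicate-zero)
  open Binomial commutativeSemiring using (theorem; binomialTerm)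
  open import Relation.Binary.Reasoning.Setoid setoid

  char∣⇒·≈0 : ∀ {p m} → p · 1# ≈ 0# → p ∣ m → ∀ x → m · x ≈ 0#
  char∣⇒·≈0 {p} p·1≈0 (divides d ≡.refl) x = begin
    (d ℕ.* p) · x      ≈⟨ ×-assocˡ x d p ⟨
    d · (p · x)        ≈⟨ ×-congʳ d (×-congʳ p (*-identityˡ x)) ⟨
    d · (p · (1# * x)) ≈⟨ ×-congʳ d (×-assoc-* p 1# x) ⟨
    d · ((p · 1#) * x) ≈⟨ ×-comm-* d _ x ⟨
    (p · 1#) * (d · x) ≈⟨ *-congʳ p·1≈0 ⟩
    0# * (d · x)       ≈⟨ zeroˡ _ ⟩
    0#                 ∎

  -- In the binomial expansion every term except the two extreme ones has a coefficient divisible by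
  -- `p` and so vanishes.
  ^p-distrib-+ : ∀ {p} → Prime p → p · 1# ≈ 0# → ∀ x y → (x ⊕ y) ^ᴿ p ≈ x ^ᴿ p ⊕ y ^ᴿ p
  ^p-distrib-+ {zero}  pr _ = contradiction ≡.refl (ℕ.≢-nonZero⁻¹ 0 {{prime⇒nonZero pr}})
  ^p-distrib-+ {suc m} pr p·1≈0 x y = begin
    (x ⊕ y) ^ᴿ suc m                                       ≈⟨ theorem (suc m) x y ⟩
    T zero ⊕ sum (T ∘ suc)                                 ≈⟨ +-cong firstTerm (sum-init-last (T ∘ suc)) ⟩
    y ^ᴿ suc m ⊕ (sum (T ∘ suc ∘ inject₁) ⊕ T (suc (fromℕ m))) ≈⟨ +-congˡ (+-cong middleTerms lastTerm) ⟩
    y ^ᴿ suc m ⊕ (0# ⊕ x ^ᴿ suc m)                         ≈⟨ +-congˡ (+-identityˡ _) ⟩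
    y ^ᴿ suc m ⊕ x ^ᴿ suc m                                ≈⟨ +-comm _ _ ⟩
    x ^ᴿ suc m ⊕ y ^ᴿ suc m                                ∎
    where
    -- The exponent of `x` grows with the index: `T zero` is the pure power of `y` and the last term
    -- that of `x`, hence the final `+-comm`.
    T = binomialTerm x y (suc m)
    firstTerm : T zero ≈ y ^ᴿ suc m
    firstTerm = trans (×-homo-1 _) (*-identityˡ _)
    lastTerm : T (suc (fromℕ m)) ≈ x ^ᴿ suc m
    lastTerm rewrite Fin.toℕ-fromℕ m | nCn≡1 (suc m) | ℕ.n∸n≡0 m =
      trans (×-homo-1 _) (*-identityʳ _)
    middleTerms : sum (T ∘ suc ∘ inject₁) ≈ 0#
    middleTerms = trans
      (sum-cong-≋ (λ k → char∣⇒·≈0 p·1≈0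
        (prime∣C pr (≡.subst (_< m) (≡.sym (Fin.toℕ-inject₁ k)) (Fin.toℕ<n k))) _))
      (sum-replicate-zero m)

  ^[p^k]-distrib-+ : ∀ {p} → Prime p → p · 1# ≈ 0# →
                     ∀ k x y → (x ⊕ y) ^ᴿ (p ^ k) ≈ x ^ᴿ (p ^ k) ⊕ y ^ᴿ (p ^ k)
  ^[p^k]-distrib-+ pr p·1≈0 zero x y =
    trans (*-identityʳ _) (sym (+-cong (*-identityʳ x) (*-identityʳ y)))
  ^[p^k]-distrib-+ {p} pr p·1≈0 (suc k) x y = begin
    (x ⊕ y) ^ᴿ (p ^ suc k)                     ≈⟨ ^-assocʳ _ p (p ^ k) ⟨
    ((x ⊕ y) ^ᴿ p) ^ᴿ (p ^ k)                  ≈⟨ ^-congˡ (p ^ k) (^p-distrib-+ pr p·1≈0 x y) ⟩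
    (x ^ᴿ p ⊕ y ^ᴿ p) ^ᴿ (p ^ k)               ≈⟨ ^[p^k]-distrib-+ pr p·1≈0 k _ _ ⟩
    (x ^ᴿ p) ^ᴿ (p ^ k) ⊕ (y ^ᴿ p) ^ᴿ (p ^ k)  ≈⟨ +-cong (^-assocʳ x p (p ^ k)) (^-assocʳ y p (p ^ k)) ⟩
    x ^ᴿ (p ^ suc k) ⊕ y ^ᴿ (p ^ suc k)        ∎

-- Characteristic and the identity x ^ N = x in a field of N elements.

module FiniteFieldProperties {c ℓ : Level} {N : ℕ} (F : FiniteField c ℓ N) where

  open FiniteField F hiding (zero) renaming (_+_ to _⊕_)
  open Exp commutativeSemiring using () renaming (_^_ to _^ᶠ_)
  open Mult semiring using (×1-homo-*; ×-homo-1) renaming (_×_ to _·_)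
  open Sum semiring using (sum; sum-cong-≋; sum-permute; sum-replicate; ∑-distrib-+)
  -- Sums in the multiplicative monoid: `Π.sum` is a product.
  module Π = CommutativeMonoidSum *-commutativeMonoid
  open RingProperties ring using (+-identityˡ-unique)
  open import Relation.Binary.Reasoning.Setoid setoid
  private module E = Bijection cardinality

  index : Carrier → Fin N
  index x = proj₁ (E.surjective x)

  to-index : ∀ x → E.to (index x) ≈ x
  to-index x = proj₂ (E.surjective x) ≡.refl

  index-cong : ∀ {x y} → x ≈ y → index x ≡ index y
  index-cong {x} {y} x≈y = E.injective (trans (to-index x) (trans x≈y (sym (to-index y))))

  index-to : ∀ i → index (E.to i) ≡ i
  index-to i = E.injective (to-index (E.to i))

  infix 4 _≟_
  -- The enumeration transports decidable equality from `Fin N` to the field; the case splits on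
  -- being zero below rest on it.
  _≟_ : ∀ x y → Dec (x ≈ y)
  x ≟ y = map′
    (λ eq → trans (sym (to-index x)) (trans (reflexive (≡.cong E.to eq)) (to-index y)))
    index-cong (index x Fin.≟ index y)

  *-cancelˡ-nonZero : ∀ {x y z} → ¬ (x ≈ 0#) → x * y ≈ x * z → y ≈ z
  *-cancelˡ-nonZero {x} {y} {z} x≉0 xy≈xz with inverse x x≉0
  ... | x⁻¹ , xx⁻¹≈1 = begin
    y               ≈⟨ cancel y ⟨
    x⁻¹ * (x * y)   ≈⟨ *-congˡ xy≈xz ⟩
    x⁻¹ * (x * z)   ≈⟨ cancel z ⟩
    z               ∎
    where
    cancel : ∀ w → x⁻¹ * (x * w) ≈ w
    cancel w = trans (sym (*-assoc _ _ _))
      (trans (*-congʳ (trans (*-comm _ _) xx⁻¹≈1)) (*-identityˡ w))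

  x*y≈0⇒y≈0 : ∀ {x y} → ¬ (x ≈ 0#) → x * y ≈ 0# → y ≈ 0#
  x*y≈0⇒y≈0 x≉0 xy≈0 = *-cancelˡ-nonZero x≉0 (trans xy≈0 (sym (zeroʳ _)))

  -- Conjugating by the enumeration turns a bijection of the field into a permutation of indices,
  -- the form in which sums and products over the field can be reordered.
  fieldPermutation : (f g : Carrier → Carrier) →
    (∀ {x y} → x ≈ y → f x ≈ f y) → (∀ {x y} → x ≈ y → g x ≈ g y) →
    (∀ x → f (g x) ≈ x) → (∀ x → g (f x) ≈ x) → Permutation′ N
  fieldPermutation f g f-cong g-cong fg gf = permutation
    (λ i → index (f (E.to i))) (λ i → index (g (E.to i)))
    (λ i → ≡.trans (index-cong (trans (f-cong (to-index _)) (fg _))) (index-to i))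
    (λ i → ≡.trans (index-cong (trans (g-cong (to-index _)) (gf _))) (index-to i))

  -- Translation by 1 permutes the field, so it preserves the sum of all elements.
  order·1≈0 : N · 1# ≈ 0#
  order·1≈0 = +-identityˡ-unique _ (sum E.to) (begin
    (N · 1#) ⊕ sum E.to                    ≈⟨ +-congʳ (sum-replicate N) ⟨
    sum (replicate N 1#) ⊕ sum E.to        ≈⟨ ∑-distrib-+ (replicate N 1#) E.to ⟨
    sum (λ i → 1# ⊕ E.to i)                ≈⟨ sum-cong-≋ (λ (i : Fin N) → to-index (1# ⊕ E.to i)) ⟨
    sum (λ i → E.to (index (1# ⊕ E.to i))) ≈⟨ sum-permute E.to translation ⟨
    sum E.to                               ∎)
    where
    translation : Permutation′ N
    translation = fieldPermutation (1# ⊕_) (- 1# ⊕_) +-congˡ +-congˡ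
      (λ x → trans (sym (+-assoc _ _ _)) (trans (+-congʳ (-‿inverseʳ 1#)) (+-identityˡ x)))
      (λ x → trans (sym (+-assoc _ _ _)) (trans (+-congʳ (-‿inverseˡ 1#)) (+-identityˡ x)))

  -- `(p ^ suc m) · 1#` is the product of `p · 1#` and `(p ^ m) · 1#`, and a field has no zero
  -- divisors, so factors `p · 1#` can be stripped until one is zero. With `order·1≈0` this
  -- identifies the characteristic.
  p^m·1≈0⇒p·1≈0 : ∀ p m → (p ^ m) · 1# ≈ 0# → p · 1# ≈ 0#
  p^m·1≈0⇒p·1≈0 p zero 1·1≈0 = contradiction (trans (sym (×-homo-1 1#)) 1·1≈0) 1≉0
  p^m·1≈0⇒p·1≈0 p (suc m) eq with p · 1# ≟ 0#
  ... | yes p·1≈0 = p·1≈0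
  ... | no  p·1≉0 = p^m·1≈0⇒p·1≈0 p m
    (x*y≈0⇒y≈0 p·1≉0 (trans (sym (×1-homo-* p (p ^ m))) eq))

  ∏≉0 : ∀ {n} (f : Vector Carrier n) → (∀ i → ¬ (f i ≈ 0#)) → ¬ (Π.sum f ≈ 0#)
  ∏≉0 {zero}  f f≉0 = 1≉0
  ∏≉0 {suc n} f f≉0 eq = ∏≉0 (f ∘ suc) (f≉0 ∘ suc) (x*y≈0⇒y≈0 (f≉0 zero) eq)

  -- The extra factor `a` makes up for the single 1 at position `i₀`, which in the application is
  -- the index of zero.
  a*∏≈a^n : ∀ {n} a (i₀ : Fin n) (g : Vector Carrier n) → g i₀ ≈ 1# →
            (∀ i → i ≢ i₀ → g i ≈ a) → a * Π.sum g ≈ a ^ᶠ n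
  a*∏≈a^n {suc n} a i₀ g gi₀≈1 g≈a = *-congˡ (begin
    Π.sum g                              ≈⟨ Π.sum-remove {i = i₀} g ⟩
    g i₀ * Π.sum (g ∘ punchIn i₀)        ≈⟨ *-cong gi₀≈1 (Π.sum-cong-≋ (λ i → g≈a _ (Fin.punchInᵢ≢i i₀ i))) ⟩
    1# * Π.sum (replicate n a)           ≈⟨ *-identityˡ _ ⟩
    Π.sum (replicate n a)                ≈⟨ Π.sum-replicate n ⟩
    a ^ᶠ n                               ∎)

  -- Putting 1 in the place of zero lets a product over the nonzero elements run over all of
  -- `Fin N`.
  ifZero_then1else_ : Carrier → Carrier → Carrier
  ifZero x then1else y with x ≟ 0#
  ... | yes _ = 1#
  ... | no  _ = y

  ifZero-yes : ∀ {x y} → x ≈ 0# → ifZero x then1else y ≈ 1#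
  ifZero-yes {x} x≈0 with x ≟ 0#
  ... | yes _   = refl
  ... | no  x≉0 = contradiction x≈0 x≉0

  ifZero-no : ∀ {x y} → ¬ (x ≈ 0#) → ifZero x then1else y ≈ y
  ifZero-no {x} x≉0 with x ≟ 0#
  ... | yes x≈0 = contradiction x≈0 x≉0
  ... | no  _   = refl

  -- For a ≉ 0, multiplication by a permutes the field, so it preserves the
  -- product of the nonzero elements.
  x^order≈x : ∀ a → a ^ᶠ N ≈ a
  x^order≈x a with a ≟ 0#
  ... | yes a≈0 = trans (0^ (index a) a≈0) (sym a≈0)
    where
    -- The zeroth power of 0 is 1, so an inhabitant of `Fin n` is passed to rule out `n = 0`;
    -- `index a` provides it for `N`.
    0^ : ∀ {n} → Fin n → ∀ {x} → x ≈ 0# → x ^ᶠ n ≈ 0#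
    0^ {suc n} _ x≈0 = trans (*-congʳ x≈0) (zeroˡ _)
  ... | no a≉0 with inverse a a≉0
  ... | b , ab≈1 = begin
    a ^ᶠ N            ≈⟨ a*∏≈a^n a (index 0#) (g ∘ E.to) (ifZero-yes (to-index 0#)) (λ i i≢ →
                           ifZero-no (λ eq → i≢ (≡.trans (≡.sym (index-to i)) (index-cong eq)))) ⟨
    a * Π.sum (g ∘ E.to) ≈⟨ *-congˡ ∏g≈1 ⟩
    a * 1#            ≈⟨ *-identityʳ a ⟩
    a                 ∎
    where
    -- Over the whole field `f` has as product `P`, that of the nonzero elements, and `g` has a ^ (N
    -- - 1). Since `f (a * x)` is `g x * f x`, reordering gives `P` times the product of `g` equal
    -- to `P`, and the nonzero `P` cancels.
    f g : Carrier → Carrier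
    f x = ifZero x then1else x
    g x = ifZero x then1else a

    f-cong : ∀ {x y} → x ≈ y → f x ≈ f y
    f-cong {x} {y} x≈y with x ≟ 0# | y ≟ 0#
    ... | yes _   | yes _   = refl
    ... | yes x≈0 | no y≉0  = contradiction (trans (sym x≈y) x≈0) y≉0
    ... | no x≉0  | yes y≈0 = contradiction (trans x≈y y≈0) x≉0
    ... | no _    | no _    = x≈y

    f≉0 : ∀ x → ¬ (f x ≈ 0#)
    f≉0 x with x ≟ 0#
    ... | yes _   = 1≉0
    ... | no x≉0  = x≉0

    f[ax]≈gx*fx : ∀ x → f (a * x) ≈ g x * f x
    f[ax]≈gx*fx x with x ≟ 0#
    ... | yes x≈0 = trans (ifZero-yes (trans (*-congˡ x≈0) (zeroʳ a))) (sym (*-identityˡ 1#))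
    ... | no x≉0  = ifZero-no (λ ax≈0 → x≉0 (x*y≈0⇒y≈0 a≉0 ax≈0))

    scaling : Permutation′ N
    scaling = fieldPermutation (a *_) (b *_) *-congˡ *-congˡ
      (λ x → trans (sym (*-assoc _ _ _)) (trans (*-congʳ ab≈1) (*-identityˡ x)))
      (λ x → trans (sym (*-assoc _ _ _)) (trans (*-congʳ (trans (*-comm b a) ab≈1)) (*-identityˡ x)))

    P = Π.sum (f ∘ E.to)

    ∏g≈1 : Π.sum (g ∘ E.to) ≈ 1#
    ∏g≈1 = *-cancelˡ-nonZero (∏≉0 (f ∘ E.to) (f≉0 ∘ E.to)) (begin
      P * Π.sum (g ∘ E.to)                    ≈⟨ *-comm _ _ ⟩
      Π.sum (g ∘ E.to) * P                    ≈⟨ Π.∑-distrib-+ (g ∘ E.to) (f ∘ E.to) ⟨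
      Π.sum (λ i → g (E.to i) * f (E.to i))   ≈⟨ Π.sum-cong-≋ (λ i → f[ax]≈gx*fx (E.to i)) ⟨
      Π.sum (λ i → f (a * E.to i))            ≈⟨ Π.sum-cong-≋ (λ (i : Fin N) → f-cong (to-index (a * E.to i))) ⟨
      Π.sum (λ i → f (E.to (index (a * E.to i)))) ≈⟨ Π.sum-permute (f ∘ E.to) scaling ⟨
      P                                       ≈⟨ *-identityʳ P ⟨
      P * 1#                                  ∎)

-- Matrices acting on column vectors.

module MatrixProperties {c ℓ : Level} {order : ℕ} (F : FiniteField c ℓ order) where

  open FiniteField F hiding (zero) renaming (_+_ to _⊕_)
  open Matrices F
  open Sum semiring using (sum; sum-cong-≋; sum-replicate-zero; ∑-distrib-+; ∑-comm; *-distribˡ-sum; *-distribʳ-sum)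
  open RingProperties ring using (-‿distribˡ-*; -0#≈0#; -‿+-comm; x∙y⁻¹≈ε⇒x≈y)
  open import Relation.Binary.Reasoning.Setoid setoid

  infix 4 _≈ⱽ_
  _≈ⱽ_ : ∀ {n} → Vector Carrier n → Vector Carrier n → Set ℓ
  u ≈ⱽ v = ∀ i → u i ≈ v i

  infixl 6 _+ⱽ_
  _+ⱽ_ : ∀ {n} → Vector Carrier n → Vector Carrier n → Vector Carrier n
  (u +ⱽ v) i = u i ⊕ v i

  0ⱽ : ∀ {n} → Vector Carrier n
  0ⱽ i = 0#

  infixr 7 _*ⱽ_
  _*ⱽ_ : ∀ {m n} → Matrix m n → Vector Carrier n → Vector Carrier m
  (A *ⱽ v) i = sum (λ k → A i k * v k)

  sum-0 : ∀ {n} (f : Vector Carrier n) → f ≈ⱽ 0ⱽ → sum f ≈ 0#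
  sum-0 {n} f f≈0 = trans (sum-cong-≋ f≈0) (sum-replicate-zero n)

  sum-neg : ∀ {n} (f : Vector Carrier n) → sum (λ i → - f i) ≈ - sum f
  sum-neg {zero}  f = sym -0#≈0#
  sum-neg {suc n} f = trans (+-congˡ (sum-neg (f ∘ suc))) (-‿+-comm _ _)

  I-suc : ∀ {n} (i j : Fin n) → I (suc i) (suc j) ≈ I i j
  I-suc i j with i Fin.≟ j
  ... | yes _ = refl
  ... | no  _ = refl

  I-diagonal : ∀ {n} (i : Fin n) → I i i ≈ 1#
  I-diagonal i with i Fin.≟ i
  ... | yes _  = refl
  ... | no i≢i = contradiction ≡.refl i≢i

  I-offDiagonal : ∀ {n} {i j : Fin n} → i ≢ j → I i j ≈ 0#
  I-offDiagonal {i = i} {j} i≢j with i Fin.≟ j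
  ... | yes i≡j = contradiction i≡j i≢j
  ... | no _    = refl

  *ⱽ-identityˡ : ∀ {n} (v : Vector Carrier n) → I *ⱽ v ≈ⱽ v
  *ⱽ-identityˡ {suc n} v zero = begin
    1# * v zero ⊕ sum (λ k → 0# * v (suc k)) ≈⟨ +-cong (*-identityˡ _) (sum-0 (λ k → 0# * v (suc k)) (λ k → zeroˡ _)) ⟩
    v zero ⊕ 0#                              ≈⟨ +-identityʳ _ ⟩
    v zero                                   ∎
  *ⱽ-identityˡ {suc n} v (suc i) = begin
    0# * v zero ⊕ sum (λ k → I (suc i) (suc k) * v (suc k))
      ≈⟨ +-cong (zeroˡ _) (sum-cong-≋ (λ k → *-congʳ (I-suc i k))) ⟩
    0# ⊕ (I *ⱽ (v ∘ suc)) i ≈⟨ +-identityˡ _ ⟩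
    (I *ⱽ (v ∘ suc)) i      ≈⟨ *ⱽ-identityˡ (v ∘ suc) i ⟩
    v (suc i)               ∎

  *ⱽ-cong : ∀ {m n} {A B : Matrix m n} {u v} → A ≈ᴹ B → u ≈ⱽ v → A *ⱽ u ≈ⱽ B *ⱽ v
  *ⱽ-cong A≈B u≈v i = sum-cong-≋ (λ k → *-cong (A≈B i k) (u≈v k))

  *ⱽ-congˡ : ∀ {m n} (A : Matrix m n) {u v} → u ≈ⱽ v → A *ⱽ u ≈ⱽ A *ⱽ v
  *ⱽ-congˡ A = *ⱽ-cong {A = A} (λ i j → refl)

  *ⱽ-congʳ : ∀ {m n} {A B : Matrix m n} v → A ≈ᴹ B → A *ⱽ v ≈ⱽ B *ⱽ v
  *ⱽ-congʳ v A≈B = *ⱽ-cong A≈B (λ _ → refl)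

  *ⱽ-zeroˡ : ∀ {m n} (v : Vector Carrier n) → O {m} *ⱽ v ≈ⱽ 0ⱽ
  *ⱽ-zeroˡ v i = sum-0 (λ k → 0# * v k) (λ k → zeroˡ _)

  *ⱽ-zeroʳ : ∀ {m n} (A : Matrix m n) → A *ⱽ 0ⱽ ≈ⱽ 0ⱽ
  *ⱽ-zeroʳ A i = sum-0 (λ k → A i k * 0#) (λ k → zeroʳ _)

  *ⱽ-distribˡ : ∀ {m n} (A : Matrix m n) u v → A *ⱽ (u +ⱽ v) ≈ⱽ A *ⱽ u +ⱽ A *ⱽ v
  *ⱽ-distribˡ A u v i = trans (sum-cong-≋ (λ k → distribˡ (A i k) (u k) (v k)))
    (∑-distrib-+ (λ k → A i k * u k) (λ k → A i k * v k))

  *ⱽ-distribʳ-- : ∀ {m n} (A B : Matrix m n) v i → ((A -ᴹ B) *ⱽ v) i ≈ (A *ⱽ v) i - (B *ⱽ v) i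
  *ⱽ-distribʳ-- A B v i = begin
    sum (λ k → (A i k - B i k) * v k)
      ≈⟨ sum-cong-≋ (λ k → trans (distribʳ (v k) (A i k) (- B i k)) (+-congˡ (sym (-‿distribˡ-* (B i k) (v k))))) ⟩
    sum (λ k → A i k * v k ⊕ - (B i k * v k))
      ≈⟨ ∑-distrib-+ (λ k → A i k * v k) (λ k → - (B i k * v k)) ⟩
    (A *ⱽ v) i ⊕ sum (λ k → - (B i k * v k))
      ≈⟨ +-congˡ (sum-neg (λ k → B i k * v k)) ⟩
    (A *ⱽ v) i - (B *ⱽ v) i ∎

  *ⱽ-assoc : ∀ {l m n} (A : Matrix l m) (B : Matrix m n) v → (A *ᴹ B) *ⱽ v ≈ⱽ A *ⱽ B *ⱽ v
  *ⱽ-assoc A B v i = begin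
    sum (λ k → sum (λ j → A i j * B j k) * v k)
      ≈⟨ sum-cong-≋ (λ k → *-distribʳ-sum (v k) (λ j → A i j * B j k)) ⟩
    sum (λ k → sum (λ j → A i j * B j k * v k))
      ≈⟨ ∑-comm (λ k j → A i j * B j k * v k) ⟩
    sum (λ j → sum (λ k → A i j * B j k * v k))
      ≈⟨ sum-cong-≋ (λ j → sum-cong-≋ (λ k → *-assoc (A i j) (B j k) (v k))) ⟩
    sum (λ j → sum (λ k → A i j * (B j k * v k)))
      ≈⟨ sum-cong-≋ (λ j → *-distribˡ-sum (A i j) (λ k → B j k * v k)) ⟨
    sum (λ j → A i j * sum (λ k → B j k * v k)) ∎

  leftInverse⇒trivialKernel : ∀ {m n} {A : Matrix m n} (B : Matrix n m) → B *ᴹ A ≈ᴹ I →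
                              ∀ v → A *ⱽ v ≈ⱽ 0ⱽ → v ≈ⱽ 0ⱽ
  leftInverse⇒trivialKernel {A = A} B BA≈I v Av≈0 i = begin
    v i                ≈⟨ *ⱽ-identityˡ v i ⟨
    (I *ⱽ v) i         ≈⟨ *ⱽ-congʳ v BA≈I i ⟨
    ((B *ᴹ A) *ⱽ v) i  ≈⟨ *ⱽ-assoc B A v i ⟩
    (B *ⱽ A *ⱽ v) i    ≈⟨ *ⱽ-congˡ B Av≈0 i ⟩
    (B *ⱽ 0ⱽ) i        ≈⟨ *ⱽ-zeroʳ B i ⟩
    0#                 ∎

  agree⇒kernel : ∀ {m n} (A B : Matrix m n) v → A *ⱽ v ≈ⱽ B *ⱽ v → (A -ᴹ B) *ⱽ v ≈ⱽ 0ⱽ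
  agree⇒kernel A B v eq i = trans (*ⱽ-distribʳ-- A B v i) (trans (+-congʳ (eq i)) (-‿inverseʳ _))

  kernel⇒agree : ∀ {m n} (A B : Matrix m n) v → (A -ᴹ B) *ⱽ v ≈ⱽ 0ⱽ → A *ⱽ v ≈ⱽ B *ⱽ v
  kernel⇒agree A B v eq i = x∙y⁻¹≈ε⇒x≈y _ _ (trans (sym (*ⱽ-distribʳ-- A B v i)) (eq i))

  -- Full rank from a trivial kernel.

  -- If the vectors at distinct `k` and `l` coincided, the difference of the `k`-th and `l`-th unit
  -- vectors would be a vanishing combination with coefficient 1 at `k`.
  independent⇒injective : ∀ {m r} (v : Vector (Vector Carrier m) r) → LinearlyIndependent v →
                          ∀ {k l} → (∀ i → v k i ≈ v l i) → k ≡ l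
  independent⇒injective {r = r} v indep {k} {l} vk≈vl with k Fin.≟ l
  ... | yes k≡l = k≡l
  ... | no  k≢l = contradiction (begin
      1#            ≈⟨ I-diagonal k ⟨
      I k k         ≈⟨ x∙y⁻¹≈ε⇒x≈y _ _ (indep a dependence k) ⟩
      I l k         ≈⟨ I-offDiagonal (k≢l ∘ ≡.sym) ⟩
      0#            ∎) 1≉0
    where
    a : Vector Carrier r
    a j = I k j - I l j
    dependence : ∀ i → sum (λ j → a j * v j i) ≈ 0#
    dependence i = begin
      -- The sum is read as an entry of a matrix with constant rows `a`, so that the distributive
      -- law for `-ᴹ` splits it into two rows of `I`.
      ((λ _ → a) *ⱽ column) k
        ≈⟨ *ⱽ-distribʳ-- (λ _ → I k) (λ _ → I l) column k ⟩
      (I *ⱽ column) k - (I *ⱽ column) l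
        ≈⟨ +-cong (*ⱽ-identityˡ column k) (-‿cong (*ⱽ-identityˡ column l)) ⟩
      v k i - v l i ≈⟨ +-congʳ (vk≈vl i) ⟩
      v l i - v l i ≈⟨ -‿inverseʳ _ ⟩
      0# ∎
      where
      column : Vector Carrier r
      column j = v j i

  -- A linear combination of all the columns is a value `A *ⱽ v`, so the whole family is
  -- independent. No longer family exists, because independent columns have distinct indices in
  -- `Fin n`.
  trivialKernel⇒fullRank : ∀ {m n} (A : Matrix m n) → (∀ v → A *ⱽ v ≈ⱽ 0ⱽ → v ≈ⱽ 0ⱽ) → IsRank A n
  trivialKernel⇒fullRank A trivial = record
    { attained = id , λ a eq → trivial a (λ i → trans (sum-cong-≋ (λ k → *-comm (A i k) (a k))) (eq i))
    ; maximal  = λ s (f , indep) → Fin.injective⇒≤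
        (λ {k} {l} fk≡fl → independent⇒injective (λ k i → A i (f k)) indep
          (λ i → reflexive (≡.cong (A i) fk≡fl)))
    }

  -- Block matrices acting on the two halves of a vector.

  sum-cast : ∀ {m n} (m≡n : m ≡ n) (f : Vector Carrier n) → sum f ≈ sum (f ∘ cast m≡n)
  sum-cast ≡.refl f = sum-cong-≋ (λ k → reflexive (≡.cong f (≡.sym (Fin.cast-is-id ≡.refl k))))

  sum-↑ : ∀ m {n} (f : Vector Carrier (m + n)) → sum f ≈ sum (λ i → f (i ↑ˡ n)) ⊕ sum (λ j → f (m ↑ʳ j))
  sum-↑ zero    f = sym (+-identityˡ _)
  sum-↑ (suc m) f = trans (+-congˡ (sum-↑ m (f ∘ suc))) (sym (+-assoc _ _ _))

  module Block {h n : ℕ} (h+h≡n : h + h ≡ n) where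

    inˡ inʳ : Fin h → Fin n
    inˡ i = cast h+h≡n (i ↑ˡ h)
    inʳ i = cast h+h≡n (h ↑ʳ i)

    -- Unfolds to the same expression as the local `half` inside `block`, so case analysis on it
    -- makes block entries compute.
    half : Fin n → Fin h ⊎ Fin h
    half k = splitAt h (cast (≡.sym h+h≡n) k)

    half-inˡ : ∀ i → half (inˡ i) ≡ inj₁ i
    half-inˡ i = ≡.trans (≡.cong (splitAt h) (Fin.cast-involutive (≡.sym h+h≡n) h+h≡n _)) (Fin.splitAt-↑ˡ h i h)

    half-inʳ : ∀ i → half (inʳ i) ≡ inj₂ i
    half-inʳ i = ≡.trans (≡.cong (splitAt h) (Fin.cast-involutive (≡.sym h+h≡n) h+h≡n _)) (Fin.splitAt-↑ʳ h h i)

    in-half : ∀ k → cast h+h≡n (join h h (half k)) ≡ k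
    in-half k = ≡.trans (≡.cong (cast h+h≡n) (Fin.join-splitAt h h _)) (Fin.cast-involutive h+h≡n (≡.sym h+h≡n) k)

    half-elim : ∀ {p} (P : Fin n → Set p) → (∀ i → P (inˡ i)) → (∀ i → P (inʳ i)) → ∀ k → P k
    half-elim P Pˡ Pʳ k = ≡.subst P (in-half k) (P-join (half k))
      where
      P-join : ∀ s → P (cast h+h≡n (join h h s))
      P-join (inj₁ i) = Pˡ i
      P-join (inj₂ i) = Pʳ i

    private
      -- `block` with both index splits abstracted, so that they can be rewritten together by
      -- `≡.cong₂`.
      entry : (A B C D : Matrix h h) → Fin h ⊎ Fin h → Fin h ⊎ Fin h → Carrier
      entry A B C D s t = [ (λ i → [ A i , B i ]′ t) , (λ i → [ C i , D i ]′ t) ]′ s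

    module _ (A B C D : Matrix h h) where

      block-inˡ-inˡ : ∀ i j → block h+h≡n A B C D (inˡ i) (inˡ j) ≡ A i j
      block-inˡ-inˡ i j = ≡.cong₂ (entry A B C D) (half-inˡ i) (half-inˡ j)

      block-inˡ-inʳ : ∀ i j → block h+h≡n A B C D (inˡ i) (inʳ j) ≡ B i j
      block-inˡ-inʳ i j = ≡.cong₂ (entry A B C D) (half-inˡ i) (half-inʳ j)

      block-inʳ-inˡ : ∀ i j → block h+h≡n A B C D (inʳ i) (inˡ j) ≡ C i j
      block-inʳ-inˡ i j = ≡.cong₂ (entry A B C D) (half-inʳ i) (half-inˡ j)

      block-inʳ-inʳ : ∀ i j → block h+h≡n A B C D (inʳ i) (inʳ j) ≡ D i j
      block-inʳ-inʳ i j = ≡.cong₂ (entry A B C D) (half-inʳ i) (half-inʳ j)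

      block-*ⱽ-inˡ : ∀ v i → (block h+h≡n A B C D *ⱽ v) (inˡ i) ≈ (A *ⱽ (v ∘ inˡ) +ⱽ B *ⱽ (v ∘ inʳ)) i
      block-*ⱽ-inˡ v i = trans (sum-cast h+h≡n _) (trans (sum-↑ h _) (+-cong
        (sum-cong-≋ (λ j → *-congʳ {v (inˡ j)} (reflexive (block-inˡ-inˡ i j))))
        (sum-cong-≋ (λ j → *-congʳ {v (inʳ j)} (reflexive (block-inˡ-inʳ i j))))))

      block-*ⱽ-inʳ : ∀ v i → (block h+h≡n A B C D *ⱽ v) (inʳ i) ≈ (C *ⱽ (v ∘ inˡ) +ⱽ D *ⱽ (v ∘ inʳ)) i
      block-*ⱽ-inʳ v i = trans (sum-cast h+h≡n _) (trans (sum-↑ h _) (+-cong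
        (sum-cong-≋ (λ j → *-congʳ {v (inˡ j)} (reflexive (block-inʳ-inˡ i j))))
        (sum-cong-≋ (λ j → *-congʳ {v (inʳ j)} (reflexive (block-inʳ-inʳ i j))))))

-- The conjugation x ^ q and the conjugate transpose.

module HermitianProperties {c ℓ : Level} (q : ℕ) (q-primePower : IsPrimePower q)
                           (F : FiniteField c ℓ (q ^ 2)) where

  open FiniteField F hiding (zero) renaming (_+_ to _⊕_)
  open FiniteFieldProperties F using (order·1≈0; p^m·1≈0⇒p·1≈0; x^order≈x)
  open HermitianMatrices q F
  open MatrixProperties F
  open Exp commutativeSemiring using (^-congˡ; ^-congʳ; ^-assocʳ; ^-distrib-*) renaming (_^_ to _^ᶠ_)
  open Mult semiring using (×-congˡ)
  open Sum semiring using (sum; sum-cong-≋)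
  open Frobenius commutativeRing using (^[p^k]-distrib-+)
  open RingProperties ring using (+-identityˡ-unique; +-inverseʳ-unique; +-cancelˡ)
  open import Relation.Binary.Reasoning.Setoid setoid

  -- With q = p ^ k the field has p ^ (2k) elements, so p ^ (2k) times 1 is zero and the
  -- characteristic is p; conjugation is then a k-fold p-th power.
  conj-+ : ∀ x y → (x ⊕ y) ^ᶠ q ≈ x ^ᶠ q ⊕ y ^ᶠ q
  conj-+ x y = additive q-primePower
    where
    additive : IsPrimePower q → (x ⊕ y) ^ᶠ q ≈ x ^ᶠ q ⊕ y ^ᶠ q
    additive (p , k , p-prime , _ , q≡p^k) = begin
      (x ⊕ y) ^ᶠ q                   ≈⟨ ^-congʳ (x ⊕ y) q≡p^k ⟩
      (x ⊕ y) ^ᶠ (p ^ k)             ≈⟨ ^[p^k]-distrib-+ p-prime p·1≈0 k x y ⟩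
      x ^ᶠ (p ^ k) ⊕ y ^ᶠ (p ^ k)    ≈⟨ +-cong (^-congʳ x q≡p^k) (^-congʳ y q≡p^k) ⟨
      x ^ᶠ q ⊕ y ^ᶠ q                ∎
      where
      q^2≡p^[k*2] : q ^ 2 ≡ p ^ (k ℕ.* 2)
      q^2≡p^[k*2] = ≡.trans (≡.cong (_^ 2) q≡p^k) (ℕ.^-*-assoc p k 2)
      p·1≈0 = p^m·1≈0⇒p·1≈0 p (k ℕ.* 2) (trans (sym (×-congˡ q^2≡p^[k*2])) order·1≈0)

  conj-involutive : ∀ x → (x ^ᶠ q) ^ᶠ q ≈ x
  conj-involutive x = begin
    (x ^ᶠ q) ^ᶠ q     ≈⟨ ^-assocʳ x q q ⟩
    x ^ᶠ (q ℕ.* q)    ≈⟨ ^-congʳ x (≡.cong (q ℕ.*_) (ℕ.*-identityʳ q)) ⟨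
    x ^ᶠ (q ^ 2)      ≈⟨ x^order≈x x ⟩
    x                 ∎

  -- By additivity the power z satisfies z + z = z, which settles the matter without inspecting the
  -- exponent.
  conj-0 : 0# ^ᶠ q ≈ 0#
  conj-0 = +-identityˡ-unique _ _ (trans (sym (conj-+ 0# 0#)) (^-congˡ q (+-identityˡ 0#)))

  conj-1 : 1# ^ᶠ q ≈ 1#
  conj-1 = 1^ q
    where
    1^ : ∀ n → 1# ^ᶠ n ≈ 1#
    1^ zero    = refl
    1^ (suc n) = trans (*-identityˡ _) (1^ n)

  conj-neg : ∀ x → (- x) ^ᶠ q ≈ - (x ^ᶠ q)
  conj-neg x = +-inverseʳ-unique _ _
    (trans (sym (conj-+ x (- x))) (trans (^-congˡ q (-‿inverseʳ x)) conj-0))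

  conj-sum : ∀ {n} (f : Vector Carrier n) → sum f ^ᶠ q ≈ sum (λ i → f i ^ᶠ q)
  conj-sum {zero}  f = conj-0
  conj-sum {suc n} f = trans (conj-+ _ _) (+-congˡ (conj-sum (f ∘ suc)))

  ⋆-cong : ∀ {m n} {A B : Matrix m n} → A ≈ᴹ B → A ⋆ ≈ᴹ B ⋆
  ⋆-cong A≈B i j = ^-congˡ q (A≈B j i)

  ⋆-- : ∀ {m n} (A B : Matrix m n) → (A -ᴹ B) ⋆ ≈ᴹ A ⋆ -ᴹ B ⋆
  ⋆-- A B i j = trans (conj-+ _ _) (+-congˡ (conj-neg _))

  ⋆-* : ∀ {l m n} (A : Matrix l m) (B : Matrix m n) → (A *ᴹ B) ⋆ ≈ᴹ B ⋆ *ᴹ A ⋆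
  ⋆-* A B i j = trans (conj-sum (λ k → A j k * B k i))
    (sum-cong-≋ (λ k → trans (^-distrib-* (A j k) (B k i) q) (*-comm _ _)))

  I⋆≈I : ∀ {n} → I {n} ⋆ ≈ᴹ I
  I⋆≈I i j with i Fin.≟ j | j Fin.≟ i
  ... | yes _   | yes _   = conj-1
  ... | yes i≡j | no j≢i  = contradiction (≡.sym i≡j) j≢i
  ... | no i≢j  | yes j≡i = contradiction (≡.sym j≡i) i≢j
  ... | no _    | no _    = conj-0

  A*A⋆-hermitian : ∀ {m n} (A : Matrix m n) → (A *ᴹ A ⋆) ⋆ ≈ᴹ A *ᴹ A ⋆
  A*A⋆-hermitian A i j = trans (⋆-* A (A ⋆) i j)
    (sum-cong-≋ (λ k → *-congʳ (conj-involutive (A i k))))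

  -- `⋆` reverses products, so it carries a right inverse of `A` to a left inverse of `A ⋆`.
  nonsingular⇒⋆-trivialKernel : ∀ {n} {A : Matrix n n} → Nonsingular A → ∀ v → A ⋆ *ⱽ v ≈ⱽ 0ⱽ → v ≈ⱽ 0ⱽ
  nonsingular⇒⋆-trivialKernel {A = A} (B , AB≈I , _) = leftInverse⇒trivialKernel (B ⋆)
    (λ i j → trans (sym (⋆-* A B i j)) (trans (⋆-cong AB≈I i j) (I⋆≈I i j)))

  -- The set Y: Hermitian members, rank distance and size.

  module Code {n : ℕ} (2∣n : 2 ∣ n) where

    open Block {n / 2} (n/2+n/2≡n 2∣n)

    block-hermitian : ∀ {A B C D} → A ⋆ ≈ᴹ A → C ⋆ ≈ᴹ B → B ⋆ ≈ᴹ C → D ⋆ ≈ᴹ D →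
                      X n (block {n / 2} (n/2+n/2≡n 2∣n) A B C D)
    block-hermitian A⋆≈A C⋆≈B B⋆≈C D⋆≈D i j with half i | half j
    ... | inj₁ i′ | inj₁ j′ = A⋆≈A i′ j′
    ... | inj₁ i′ | inj₂ j′ = C⋆≈B i′ j′
    ... | inj₂ i′ | inj₁ j′ = B⋆≈C i′ j′
    ... | inj₂ i′ | inj₂ j′ = D⋆≈D i′ j′

    codeMatrix-hermitian : ∀ A → X n (codeMatrix 2∣n A)
    codeMatrix-hermitian A = block-hermitian {A = I} {A ⋆} {A} {A *ᴹ A ⋆} I⋆≈I (λ _ _ → refl)
      (λ i j → conj-involutive (A i j)) (A*A⋆-hermitian A)

    extraMatrix-hermitian : X n (extraMatrix 2∣n)
    extraMatrix-hermitian = block-hermitian {A = O} {O} {O} {I}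
      (λ _ _ → conj-0) (λ _ _ → conj-0) (λ _ _ → conj-0) I⋆≈I

    X-respects-≈ : ∀ {M N} → N ≈ᴹ M → X n M → X n N
    X-respects-≈ N≈M M∈X i j = trans (⋆-cong N≈M i j) (trans (M∈X i j) (sym (N≈M i j)))

    -- With `v ∘ inˡ` as u and `v ∘ inʳ` as w, this is the vector t for which `codeMatrix` sends (u
    -- , w) to (t , A t).
    image : Matrix (n / 2) (n / 2) → Vector Carrier n → Vector Carrier (n / 2)
    image A v = v ∘ inˡ +ⱽ A ⋆ *ⱽ (v ∘ inʳ)

    codeMatrix-*ⱽ-inˡ : ∀ A v i → (codeMatrix 2∣n A *ⱽ v) (inˡ i) ≈ image A v i
    codeMatrix-*ⱽ-inˡ A v i = trans (block-*ⱽ-inˡ _ _ _ _ v i) (+-congʳ (*ⱽ-identityˡ (v ∘ inˡ) i))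

    codeMatrix-*ⱽ-inʳ : ∀ A v i → (codeMatrix 2∣n A *ⱽ v) (inʳ i) ≈ (A *ⱽ image A v) i
    codeMatrix-*ⱽ-inʳ A v i = begin
      (codeMatrix 2∣n A *ⱽ v) (inʳ i)                       ≈⟨ block-*ⱽ-inʳ _ _ _ _ v i ⟩
      (A *ⱽ (v ∘ inˡ)) i ⊕ ((A *ᴹ A ⋆) *ⱽ (v ∘ inʳ)) i      ≈⟨ +-congˡ (*ⱽ-assoc A (A ⋆) (v ∘ inʳ) i) ⟩
      (A *ⱽ (v ∘ inˡ) +ⱽ A *ⱽ A ⋆ *ⱽ (v ∘ inʳ)) i           ≈⟨ *ⱽ-distribˡ A (v ∘ inˡ) (A ⋆ *ⱽ (v ∘ inʳ)) i ⟨
      (A *ⱽ image A v) i                                    ∎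

    extraMatrix-*ⱽ-inˡ : ∀ v i → (extraMatrix 2∣n *ⱽ v) (inˡ i) ≈ 0#
    extraMatrix-*ⱽ-inˡ v i = trans (block-*ⱽ-inˡ _ _ _ _ v i)
      (trans (+-cong (*ⱽ-zeroˡ (v ∘ inˡ) i) (*ⱽ-zeroˡ (v ∘ inʳ) i)) (+-identityˡ 0#))

    extraMatrix-*ⱽ-inʳ : ∀ v i → (extraMatrix 2∣n *ⱽ v) (inʳ i) ≈ v (inʳ i)
    extraMatrix-*ⱽ-inʳ v i = trans (block-*ⱽ-inʳ _ _ _ _ v i)
      (trans (+-cong (*ⱽ-zeroˡ (v ∘ inˡ) i) (*ⱽ-identityˡ (v ∘ inʳ) i)) (+-identityˡ _))

    image≈0⇒v≈0 : ∀ A v → image A v ≈ⱽ 0ⱽ → v ∘ inʳ ≈ⱽ 0ⱽ → v ≈ⱽ 0ⱽ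
    image≈0⇒v≈0 A v t≈0 w≈0 = half-elim (λ k → v k ≈ 0#) u≈0 w≈0
      where
      u≈0 : v ∘ inˡ ≈ⱽ 0ⱽ
      u≈0 i = begin
        v (inˡ i)                         ≈⟨ +-identityʳ _ ⟨
        v (inˡ i) ⊕ 0#                    ≈⟨ +-congˡ (trans (*ⱽ-congˡ (A ⋆) w≈0 i) (*ⱽ-zeroʳ (A ⋆) i)) ⟨
        v (inˡ i) ⊕ (A ⋆ *ⱽ (v ∘ inʳ)) i  ≈⟨ t≈0 i ⟩
        0#                                ∎

    -- Triviality of the kernel of `M -ᴹ N`, phrased without subtraction so that the two products
    -- can be computed separately on each half.
    AgreeOnlyAt0 : Matrix n n → Matrix n n → Set (c ⊔ ℓ)
    AgreeOnlyAt0 M N = ∀ v → M *ⱽ v ≈ⱽ N *ⱽ v → v ≈ⱽ 0ⱽ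

    AgreeOnlyAt0-sym : ∀ {M N} → AgreeOnlyAt0 M N → AgreeOnlyAt0 N M
    AgreeOnlyAt0-sym only0 v eq = only0 v (λ i → sym (eq i))

    AgreeOnlyAt0⇒fullRank : ∀ {M N M′ N′} → M ≈ᴹ M′ → N ≈ᴹ N′ → AgreeOnlyAt0 M′ N′ → IsRank (M -ᴹ N) n
    AgreeOnlyAt0⇒fullRank {M} {N} M≈M′ N≈N′ only0 = trivialKernel⇒fullRank (M -ᴹ N) (λ v Kv≈0 →
      only0 v (λ i → begin
        _            ≈⟨ *ⱽ-congʳ v M≈M′ i ⟨
        (M *ⱽ v) i   ≈⟨ kernel⇒agree M N v Kv≈0 i ⟩
        (N *ⱽ v) i   ≈⟨ *ⱽ-congʳ v N≈N′ i ⟩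
        _            ∎))

    code-code : ∀ A B → Nonsingular (A -ᴹ B) → AgreeOnlyAt0 (codeMatrix 2∣n A) (codeMatrix 2∣n B)
    code-code A B A-B-nonsingular@(_ , _ , leftInverse) v eq = image≈0⇒v≈0 A v t≈0 w≈0
      where
      images≈ : image A v ≈ⱽ image B v
      images≈ i = trans (sym (codeMatrix-*ⱽ-inˡ A v i)) (trans (eq (inˡ i)) (codeMatrix-*ⱽ-inˡ B v i))
      t≈0 : image A v ≈ⱽ 0ⱽ
      -- The upper halves show that the two images agree; the lower halves then say that `A` and `B`
      -- agree on this common vector.
      t≈0 = leftInverse⇒trivialKernel _ leftInverse (image A v) (agree⇒kernel A B (image A v) (λ i → begin
        (A *ⱽ image A v) i               ≈⟨ codeMatrix-*ⱽ-inʳ A v i ⟨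
        (codeMatrix 2∣n A *ⱽ v) (inʳ i)  ≈⟨ eq (inʳ i) ⟩
        (codeMatrix 2∣n B *ⱽ v) (inʳ i)  ≈⟨ codeMatrix-*ⱽ-inʳ B v i ⟩
        (B *ⱽ image B v) i               ≈⟨ *ⱽ-congˡ B images≈ i ⟨
        (B *ⱽ image A v) i               ∎))
      w≈0 : v ∘ inʳ ≈ⱽ 0ⱽ
      -- Cancelling u from u + A⋆ w = u + B⋆ w puts w in the kernel of (A - B)⋆, which is trivial
      -- because `A -ᴹ B` is nonsingular.
      w≈0 = nonsingular⇒⋆-trivialKernel A-B-nonsingular (v ∘ inʳ) (λ i →
        trans (*ⱽ-congʳ (v ∘ inʳ) (⋆-- A B) i)
          (agree⇒kernel (A ⋆) (B ⋆) (v ∘ inʳ) (λ j → +-cancelˡ _ _ _ (images≈ j)) i))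

    code-extra : ∀ A → AgreeOnlyAt0 (codeMatrix 2∣n A) (extraMatrix 2∣n)
    code-extra A v eq = image≈0⇒v≈0 A v t≈0 w≈0
      where
      t≈0 : image A v ≈ⱽ 0ⱽ
      t≈0 i = trans (sym (codeMatrix-*ⱽ-inˡ A v i)) (trans (eq (inˡ i)) (extraMatrix-*ⱽ-inˡ v i))
      w≈0 : v ∘ inʳ ≈ⱽ 0ⱽ
      w≈0 i = begin
        v (inʳ i)                        ≈⟨ extraMatrix-*ⱽ-inʳ v i ⟨
        (extraMatrix 2∣n *ⱽ v) (inʳ i)   ≈⟨ eq (inʳ i) ⟨
        (codeMatrix 2∣n A *ⱽ v) (inʳ i)  ≈⟨ codeMatrix-*ⱽ-inʳ A v i ⟩
        (A *ⱽ image A v) i               ≈⟨ *ⱽ-congˡ A t≈0 i ⟩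
        (A *ⱽ 0ⱽ) i                      ≈⟨ *ⱽ-zeroʳ A i ⟩
        0#                               ∎

    codeMatrix-cong : ∀ {A B} → A ≈ᴹ B → codeMatrix 2∣n A ≈ᴹ codeMatrix 2∣n B
    codeMatrix-cong A≈B i j with half i | half j
    ... | inj₁ _  | inj₁ _  = refl
    ... | inj₁ i′ | inj₂ j′ = ⋆-cong A≈B i′ j′
    ... | inj₂ i′ | inj₁ j′ = A≈B i′ j′
    ... | inj₂ i′ | inj₂ j′ = sum-cong-≋ (λ k → *-cong (A≈B i′ k) (⋆-cong A≈B k j′))

    -- The lower left block recovers `A`.
    codeMatrix-injective : ∀ {A B} → codeMatrix 2∣n A ≈ᴹ codeMatrix 2∣n B → A ≈ᴹ B
    codeMatrix-injective eq i j = trans (reflexive (≡.sym (block-inʳ-inˡ _ _ _ _ i j)))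
      (trans (eq (inʳ i) (inˡ j)) (reflexive (block-inʳ-inˡ _ _ _ _ i j)))

    -- The upper left blocks are `I` and `O`, which differ at any diagonal position; `n` being
    -- nonzero guarantees that there is one.
    codeMatrix≉extraMatrix : .{{NonZero n}} → ∀ A → ¬ (codeMatrix 2∣n A ≈ᴹ extraMatrix 2∣n)
    codeMatrix≉extraMatrix A eq = 1≉0 (begin
      1#     ≈⟨ I-diagonal i₀ ⟨
      I i₀ i₀ ≡⟨ block-inˡ-inˡ _ _ _ _ i₀ i₀ ⟨
      codeMatrix 2∣n A (inˡ i₀) (inˡ i₀) ≈⟨ eq _ _ ⟩
      extraMatrix 2∣n (inˡ i₀) (inˡ i₀) ≡⟨ block-inˡ-inˡ _ _ _ _ i₀ i₀ ⟩
      0#     ∎)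
      where
      -- The first index of `Fin n` lies in one of the two halves, and its position there inhabits
      -- `Fin (n / 2)` without any arithmetic on `n / 2`.
      i₀ : Fin (n / 2)
      i₀ = [ id , id ]′ (half (fromℕ< (ℕ.>-nonZero⁻¹ n)))

    codeY-isCode : ∀ {p} (Z : MatrixSet p (n / 2) (n / 2)) →
      (∀ A B → A ∈ Z → B ∈ Z → ¬ (A ≈ᴹ B) → Nonsingular (A -ᴹ B)) →
      IsCode n (codeY 2∣n Z)
    codeY-isCode Z nonsingular = record
      { nonempty  = extraMatrix 2∣n , inj₂ (λ _ _ → refl)
      ; hermitian = λ where
          _ (inj₁ (A , _ , M≈)) → X-respects-≈ M≈ (codeMatrix-hermitian A)
          _ (inj₂ M≈)           → X-respects-≈ M≈ extraMatrix-hermitian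
      ; distance  = λ M N M∈Y N∈Y M≉N → n , distance M∈Y N∈Y M≉N , ℕ.≤-refl
      }
      where
      distance : ∀ {M N} → M ∈ codeY 2∣n Z → N ∈ codeY 2∣n Z → ¬ (M ≈ᴹ N) → IsRank (M -ᴹ N) n
      distance (inj₁ (A , A∈Z , M≈)) (inj₁ (B , B∈Z , N≈)) M≉N =
        -- The hypothesis on `Z` applies because `A ≈ᴹ B` would make the two code matrices, and with
        -- them `M` and `N`, equal.
        AgreeOnlyAt0⇒fullRank M≈ N≈ (code-code A B (nonsingular A B A∈Z B∈Z (λ A≈B →
          M≉N (λ i j → trans (M≈ i j) (trans (codeMatrix-cong A≈B i j) (sym (N≈ i j)))))))
      distance (inj₁ (A , _ , M≈)) (inj₂ N≈) _ =
        AgreeOnlyAt0⇒fullRank M≈ N≈ (code-extra A)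
      distance (inj₂ M≈) (inj₁ (B , _ , N≈)) _ =
        AgreeOnlyAt0⇒fullRank M≈ N≈ (AgreeOnlyAt0-sym (code-extra B))
      distance (inj₂ M≈) (inj₂ N≈) M≉N =
        contradiction (λ i j → trans (M≈ i j) (sym (N≈ i j))) M≉N

    -- The first `s` indices enumerate the code matrices through the enumeration of `Z`, and the
    -- last one is the extra matrix. Members are compared by their matrices alone, so the membership
    -- proofs do not affect the count.
    codeY-size : .{{NonZero n}} → ∀ {p} (Z : MatrixSet p (n / 2) (n / 2)) {s} →
                 HasSize Z s → HasSize (codeY 2∣n Z) (s + 1)
    codeY-size Z {s} Z-size = record
      { to        = element ∘ splitAt s
      ; cong      = λ where ≡.refl → λ _ _ → refl
      ; bijective = injective , surjective
      }
      where
      module Z = Bijection Z-size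

      element : Fin s ⊎ Fin 1 → ∃ (_∈ codeY 2∣n Z)
      element (inj₁ k) =
        codeMatrix 2∣n (proj₁ (Z.to k)) , inj₁ (proj₁ (Z.to k) , proj₂ (Z.to k) , λ _ _ → refl)
      element (inj₂ _) = extraMatrix 2∣n , inj₂ (λ _ _ → refl)

      element-injective : ∀ x y → proj₁ (element x) ≈ᴹ proj₁ (element y) → x ≡ y
      element-injective (inj₁ k) (inj₁ l) eq = ≡.cong inj₁ (Z.injective (codeMatrix-injective eq))
      element-injective (inj₁ k) (inj₂ _) eq = contradiction eq (codeMatrix≉extraMatrix _)
      element-injective (inj₂ _) (inj₁ l) eq =
        contradiction (λ i j → sym (eq i j)) (codeMatrix≉extraMatrix _)
      element-injective (inj₂ zero) (inj₂ zero) eq = ≡.refl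

      injective : ∀ {k l} → proj₁ (element (splitAt s k)) ≈ᴹ proj₁ (element (splitAt s l)) → k ≡ l
      injective {k} {l} eq = ≡.trans (≡.sym (Fin.join-splitAt s 1 k)) (≡.trans
        (≡.cong (join s 1) (element-injective (splitAt s k) (splitAt s l) eq))
        (Fin.join-splitAt s 1 l))

      element-surjective : (M : ∃ (_∈ codeY 2∣n Z)) → ∃ λ x → proj₁ (element x) ≈ᴹ proj₁ M
      element-surjective (M , inj₁ (A , A∈Z , M≈)) with Z.surjective (A , A∈Z)
      ... | k , to-k≈A = inj₁ k ,
        λ i j → trans (codeMatrix-cong (to-k≈A ≡.refl) i j) (sym (M≈ i j))
      element-surjective (M , inj₂ M≈) = inj₂ zero , λ i j → sym (M≈ i j)

      surjective : (M : ∃ (_∈ codeY 2∣n Z)) →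
                   ∃ λ k → ∀ {l} → l ≡ k → proj₁ (element (splitAt s l)) ≈ᴹ proj₁ M
      surjective M with element-surjective M
      ... | x , element-x≈M = join s 1 x , λ where
        ≡.refl → ≡.subst (λ y → proj₁ (element y) ≈ᴹ proj₁ M) (≡.sym (Fin.splitAt-join s 1 x)) element-x≈M

theorem4p3 : {c ℓ p : Level} (q : ℕ) → IsPrimePower q →
    (F : FiniteField c ℓ (q ^ 2)) → let open HermitianMatrices q F in
    (n : ℕ) .{{_ : NonZero n}} (2∣n : 2 ∣ n)
    (Z : MatrixSet p (n / 2) (n / 2)) → HasSize Z (q ^ n) →
    (∀ A B → A ∈ Z → B ∈ Z → ¬ (A ≈ᴹ B) → Nonsingular (A -ᴹ B)) →
    IsCode n (codeY 2∣n Z) × HasSize (codeY 2∣n Z) (q ^ n + 1)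
theorem4p3 q q-primePower F n 2∣n Z Z-size nonsingular =
  codeY-isCode Z nonsingular , codeY-size Z Z-size
  where open HermitianProperties.Code q q-primePower F 2∣n
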